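{- Let $\mathcal{T}=(P,Q,\epsilon_1,\epsilon_2)$ be a Pultr template such that $P=\vec P_0$ or $P=\vec P_1$, and $Q$ is a tree. Then there exists a digraph functor $\Omega_{\mathcal{T}}$ such that for any digraphs $G,H$ we have $\Gamma_{\mathcal{T}}(G)\to H$ if and only if $G\to\Omega_{\mathcal{T}}(H)$.
   Context: A digraph $G$ is a finite vertex set $V(G)$ (possibly empty) with an arc set $A(G)\subseteq V(G)\times V(G)$ (loops allowed). A homomorphism is an arc-preserving map of vertices; $G\to H$ means that a homomorphism of $G$ to $H$ exists. A tree is a digraph obtained by orienting each edge of a (nonempty, finite) undirected tree in exactly one direction. $\vec P_0$ is the digraph with one vertex and no arcs; $\vec P_1=(\{0,1\},\{(0,1)\})$ is a single arc. A digraph functor is a construction $\Omega$ assigning a digraph $\Omega(G)$ to every digraph $G$ such that $G\to H$ implies $\Omega(G)\to\Omega(H)$. A Pultr template is a quadruple $\mathcal{T}=(P,Q,\epsilon_1,\epsilon_2)$ where $P,Q$ are digraphs and $\epsilon_1,\epsilon_2$ are homomorphisms of $P$ to $Q$. The central Pultr functor $\Gamma_{\mathcal{T}}$ is defined as follows: for a digraph $H$, the vertices of $\Gamma_{\mathcal{T}}(H)$ are the homomorphisms $g:P\to H$, and the arcs are the couples $(g_1,g_2)$ for which there exists a homomorphism $h:Q\to H$ with $g_1=h\circ\epsilon_1$ and $g_2=h\circ\epsilon_2$. -}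

module Defs where

open import Data.Empty using (⊥)
open import Data.Fin.Base as Fin using (Fin; zero; suc; inject₁; fromℕ; combine; finToFun; funToFin)
open import Data.Fin.Patterns using (0F; 1F)
open import Data.Fin.Properties as Fin using (finToFun-funToFin; funToFin-finToFin; all?; any?)
open import Data.Nat.Base using (ℕ; zero; suc; _^_)
open import Data.Product.Base using (Σ; ∃; ∃-syntax; _×_; _,_; proj₁; proj₂)
open import Data.Sum.Base using (_⊎_)
open import Data.Vec.Base using (Vec; lookup; tabulate)
open import Data.Vec.Properties using (lookup∘tabulate; tabulate∘lookup; tabulate-cong)
open import Function.Base using (id; _∘_)
open import Function.Bundles using (_↔_; _⇔_; mk↔ₛ′; module Inverse)
open import Function.Definitions using (Injective)
open import Function.Properties.Inverse using (↔-refl; ↔-trans; ↔⇒↣)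
open import Relation.Binary.Construct.Closure.ReflexiveTransitive using (Star)
open import Relation.Binary.Definitions using (Decidable; DecidableEquality; Symmetric; Irreflexive)
open import Relation.Binary.PropositionalEquality
  using (_≡_; refl; sym; trans; cong; cong₂; subst; subst₂)
open import Relation.Nullary using (¬_; Dec; yes; no; contradiction)
open import Relation.Nullary.Decidable
  using (map′; via-injection; recompute; _×-dec_; _→-dec_)
import Relation.Unary as U

-- Finite vertex sets and decidable arc relations, so that every arc set
-- A(G) ⊆ V(G) × V(G) in the classical sense is covered.
record Digraph : Set₁ where
  field
    V      : Set
    size   : ℕ
    finite : V ↔ Fin size
    Arc    : V → V → Set
    arc?   : Decidable Arc

  index : V → Fin size
  index = Inverse.to finite

  vertex : Fin size → V
  vertex = Inverse.from finite

  vertex-index : ∀ u → vertex (index u) ≡ u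
  vertex-index = Inverse.strictlyInverseʳ finite

  index-vertex : ∀ i → index (vertex i) ≡ i
  index-vertex = Inverse.strictlyInverseˡ finite

open Digraph public using (V; size; Arc; arc?)
open Digraph using (finite; index; vertex; vertex-index; index-vertex)

IsHom : (G H : Digraph) → (V G → V H) → Set
IsHom G H f = ∀ u v → Arc G u v → Arc H (f u) (f v)

-- A homomorphism stores its underlying map as a table of values, and its
-- arc preservation irrelevantly, so that _≡_ on Hom G H is pointwise equality
-- of maps (see Hom-ext) and Hom G H is a finite set.  No generality is lost:
-- mkHom turns any arc-preserving function into a Hom.
record Hom (G H : Digraph) : Set where
  constructor hom
  field
    table  : Vec (V H) (size G)
    .isHom : IsHom G H (λ u → lookup table (index G u))

open Hom

infix 4 _⟶_
_⟶_ : Digraph → Digraph → Set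
G ⟶ H = Hom G H

infixl 8 _⟨_⟩
_⟨_⟩ : ∀ {G H} → Hom G H → V G → V H
_⟨_⟩ {G} g u = lookup (table g) (index G u)

preserves : ∀ {G H} (g : Hom G H) → IsHom G H (g ⟨_⟩)
preserves {G} {H} (hom t p) u v a = recompute (arc? H _ _) (p u v a)

private
  lookup-tabulate : ∀ G {A : Set} (f : V G → A) u →
                    lookup (tabulate (f ∘ vertex G)) (index G u) ≡ f u
  lookup-tabulate G f u =
    trans (lookup∘tabulate (f ∘ vertex G) (index G u)) (cong f (vertex-index G u))

mkHom : ∀ {G H} (f : V G → V H) → IsHom G H f → Hom G H
mkHom {G} {H} f p = hom (tabulate (f ∘ vertex G)) λ u v a →
  subst₂ (Arc H) (sym (lookup-tabulate G f u)) (sym (lookup-tabulate G f v)) (p u v a)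

mkHom-⟨⟩ : ∀ {G H} (f : V G → V H) (p : IsHom G H f) → ∀ u → mkHom {G} {H} f p ⟨ u ⟩ ≡ f u
mkHom-⟨⟩ {G} f p = lookup-tabulate G f

private
  table-≡ : ∀ {G H} {g h : Hom G H} → table g ≡ table h → g ≡ h
  table-≡ refl = refl

Hom-ext : ∀ {G H} {g h : Hom G H} → (∀ u → g ⟨ u ⟩ ≡ h ⟨ u ⟩) → g ≡ h
Hom-ext {G} {H} {g} {h} eq = table-≡
  (trans (sym (tabulate∘lookup (table g)))
    (trans (tabulate-cong pointwise) (tabulate∘lookup (table h))))
  where
  pointwise : ∀ i → lookup (table g) i ≡ lookup (table h) i
  pointwise i = subst (λ j → lookup (table g) j ≡ lookup (table h) j)
                      (index-vertex G i) (eq (vertex G i))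

infixr 9 _∘ʰ_
_∘ʰ_ : ∀ {G H K} → Hom H K → Hom G H → Hom G K
_∘ʰ_ {G} {H} {K} g f = mkHom (λ u → g ⟨ f ⟨ u ⟩ ⟩)
  λ u v a → preserves g _ _ (preserves f u v a)

finite-≟ : ∀ {A : Set} {n} → A ↔ Fin n → DecidableEquality A
finite-≟ A↔ = via-injection (↔⇒↣ A↔) Fin._≟_

allFinite? : ∀ {A : Set} {n} → A ↔ Fin n → {P : A → Set} → U.Decidable P → Dec (∀ x → P x)
allFinite? A↔ {P} P? = map′
  (λ p x → subst P (Inverse.strictlyInverseʳ A↔ x) (p (Inverse.to A↔ x)))
  (λ p i → p (Inverse.from A↔ i))
  (all? (λ i → P? (Inverse.from A↔ i)))

anyFinite? : ∀ {A : Set} {n} → A ↔ Fin n → {P : A → Set} → U.Decidable P → Dec (∃ P)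
anyFinite? A↔ {P} P? = map′
  (λ (i , p) → Inverse.from A↔ i , p)
  (λ (x , p) → Inverse.to A↔ x , subst P (sym (Inverse.strictlyInverseʳ A↔ x)) p)
  (any? (λ i → P? (Inverse.from A↔ i)))

private
  funToFin-cong : ∀ {m n} {f g : Fin m → Fin n} → (∀ i → f i ≡ g i) → funToFin f ≡ funToFin g
  funToFin-cong {zero}  eq = refl
  funToFin-cong {suc m} eq = cong₂ combine (eq zero) (funToFin-cong (eq ∘ suc))

  Vec-finite : ∀ {A : Set} {n} → A ↔ Fin n → ∀ m → Vec A m ↔ Fin (n ^ m)
  Vec-finite {A} {n} A↔ m = mk↔ₛ′ code decode code-decode decode-code
    where
    open Inverse A↔
    code : Vec A m → Fin (n ^ m)
    code xs = funToFin (λ i → to (lookup xs i))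
    decode : Fin (n ^ m) → Vec A m
    decode k = tabulate (λ i → from (finToFun k i))
    code-decode : ∀ k → code (decode k) ≡ k
    code-decode k = trans
      (funToFin-cong {m} (λ i → trans (cong to (lookup∘tabulate (λ j → from (finToFun k j)) i)) (strictlyInverseˡ _)))
      (funToFin-finToFin {m} {n} k)
    decode-code : ∀ xs → decode (code xs) ≡ xs
    decode-code xs = trans
      (tabulate-cong (λ i → trans (cong from (finToFun-funToFin (λ j → to (lookup xs j)) i))
                                  (strictlyInverseʳ _)))
      (tabulate∘lookup xs)

  record Subset {A : Set} (P : A → Set) : Set where
    constructor _∣_
    field
      value  : A
      .proof : P value
  open Subset

  suc-Subset : ∀ {n} {P : Fin (suc n) → Set} → Subset (P ∘ suc) → Subset P
  suc-Subset (i ∣ q) = suc i ∣ q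

  value-≡ : ∀ {A : Set} {P : A → Set} {x y : Subset P} → value x ≡ value y → x ≡ y
  value-≡ refl = refl

  Subset-Fin : ∀ n {P : Fin n → Set} → U.Decidable P → ∃[ k ] (Subset P ↔ Fin k)
  Subset-Fin zero    P? = 0 , mk↔ₛ′ (λ { (() ∣ _) }) (λ ()) (λ ()) (λ { (() ∣ _) })
  Subset-Fin (suc n) {P} P? with Subset-Fin n (λ i → P? (suc i)) | P? zero
  ... | k , S↔ | yes p = suc k , mk↔ₛ′ to′ from′ to-from from-to
    where
    open Inverse S↔
    to′ : Subset P → Fin (suc k)
    to′ (zero  ∣ _) = zero
    to′ (suc i ∣ q) = suc (to (i ∣ q))
    from′ : Fin (suc k) → Subset P
    from′ zero    = zero ∣ p
    from′ (suc j) = suc-Subset (from j)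
    to-from : ∀ j → to′ (from′ j) ≡ j
    to-from zero    = refl
    to-from (suc j) = cong suc (strictlyInverseˡ j)
    from-to : ∀ x → from′ (to′ x) ≡ x
    from-to (zero  ∣ _) = refl
    from-to (suc i ∣ q) = value-≡ (cong (suc ∘ value) (strictlyInverseʳ (i ∣ q)))
  ... | k , S↔ | no ¬p = k , mk↔ₛ′ to′ from′ to-from from-to
    where
    open Inverse S↔
    to′ : Subset P → Fin k
    to′ (zero  ∣ q) = contradiction (recompute (P? zero) q) ¬p
    to′ (suc i ∣ q) = to (i ∣ q)
    from′ : Fin k → Subset P
    from′ j = suc-Subset (from j)
    to-from : ∀ j → to′ (from′ j) ≡ j
    to-from j = strictlyInverseˡ j
    from-to : ∀ x → from′ (to′ x) ≡ x
    from-to (zero  ∣ q) = contradiction (recompute (P? zero) q) ¬p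
    from-to (suc i ∣ q) = value-≡ (cong (suc ∘ value) (strictlyInverseʳ (i ∣ q)))

  isHom? : ∀ G H → U.Decidable (IsHom G H)
  isHom? G H f = allFinite? (finite G) λ u → allFinite? (finite G) λ v →
    arc? G u v →-dec arc? H (f u) (f v)

  module _ (G H : Digraph) where

    tables : Vec (V H) (size G) ↔ Fin (size H ^ size G)
    tables = Vec-finite (finite H) (size G)

    open Inverse tables

    IsHomTable : Vec (V H) (size G) → Set
    IsHomTable t = IsHom G H (λ u → lookup t (index G u))

    IsHomCode : Fin (size H ^ size G) → Set
    IsHomCode k = IsHomTable (from k)

    codes : Hom G H ↔ Subset IsHomCode
    codes = mk↔ₛ′
      (λ { (hom t p) → to t ∣ subst IsHomTable (sym (strictlyInverseʳ t)) p })
      (λ { (k ∣ p) → hom (from k) p })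
      (λ x → value-≡ (strictlyInverseˡ (value x)))
      (λ g → table-≡ (strictlyInverseʳ (table g)))

Hom-finite : ∀ G H → ∃[ n ] (Hom G H ↔ Fin n)
Hom-finite G H =
  let n , S↔ = Subset-Fin (size H ^ size G) (λ k → isHom? G H _)
  in  n , ↔-trans (codes G H) S↔

infix 4 _≅_
record _≅_ (G H : Digraph) : Set where
  field
    bijection : V G ↔ V H
    arcs      : ∀ u v → Arc G u v ⇔ Arc H (Inverse.to bijection u) (Inverse.to bijection v)

P⃗₀ : Digraph
P⃗₀ = record
  { V = Fin 1 ; size = 1 ; finite = ↔-refl
  ; Arc = λ _ _ → ⊥ ; arc? = λ _ _ → no id }

P⃗₁ : Digraph
P⃗₁ = record
  { V = Fin 2 ; size = 2 ; finite = ↔-refl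
  ; Arc = λ u v → u ≡ 0F × v ≡ 1F ; arc? = λ u v → (u Fin.≟ 0F) ×-dec (v Fin.≟ 1F) }

-- `acyclic` excludes cycles c₀ — c₁ — ⋯ — c₍ₖ₊₂₎ — c₀ on at least three
-- distinct vertices.
record UndirectedTree (A : Set) : Set₁ where
  field
    _—_       : A → A → Set
    symmetric : Symmetric _—_
    loopless  : Irreflexive _≡_ _—_
    nonempty  : A
    connected : ∀ u v → Star _—_ u v
    acyclic   : ∀ k (c : Fin (suc (suc (suc k))) → A) → Injective _≡_ _≡_ c →
                (∀ i → c (inject₁ i) — c (suc i)) →
                ¬ (c (fromℕ _) — c zero)

record IsTree (G : Digraph) : Set₁ where
  field
    underlying : UndirectedTree (V G)
  open UndirectedTree underlying
  field
    arc⇒edge : ∀ {u v} → Arc G u v → u — v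
    edge⇒arc : ∀ {u v} → u — v → Arc G u v ⊎ Arc G v u
    one-way  : ∀ {u v} → Arc G u v → ¬ Arc G v u

record DigraphFunctor : Set₁ where
  field
    obj  : Digraph → Digraph
    mono : ∀ {G H} → G ⟶ H → obj G ⟶ obj H

open DigraphFunctor public

record PultrTemplate : Set₁ where
  field
    P Q   : Digraph
    ε₁ ε₂ : Hom P Q

open PultrTemplate public

Γ : PultrTemplate → Digraph → Digraph
Γ 𝒯 H = record
  { V      = Hom (P 𝒯) H
  ; size   = proj₁ (Hom-finite (P 𝒯) H)
  ; finite = proj₂ (Hom-finite (P 𝒯) H)
  ; Arc    = λ g₁ g₂ → Σ (Hom (Q 𝒯) H) λ h → g₁ ≡ h ∘ʰ ε₁ 𝒯 × g₂ ≡ h ∘ʰ ε₂ 𝒯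
  ; arc?   = λ g₁ g₂ → anyFinite? (proj₂ (Hom-finite (Q 𝒯) H)) λ h →
               (g₁ ≟ h ∘ʰ ε₁ 𝒯) ×-dec (g₂ ≟ h ∘ʰ ε₂ 𝒯)
  }
  where
  infix 4 _≟_
  _≟_ : DecidableEquality (Hom (P 𝒯) H)
  _≟_ = finite-≟ (proj₂ (Hom-finite (P 𝒯) H))

{-# OPTIONS --safe #-}

-- A homomorphism Γ(G) → H amounts to a labelling of the vertices (P = P⃗₀) or of
-- the arcs (P = P⃗₁) of G by vertices of H such that the image of every
-- homomorphism Q → G satisfies a fixed constraint W on the labels.  For Q a
-- single vertex, labellings subject to such a constraint are homomorphisms to an
-- induced subgraph of the digraph of labels.  If y is a leaf of Q attached at s,
-- extend the label of each vertex u by the set M(u) of all labels seen on the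
-- neighbours of u in the direction of y; then W becomes a constraint for Q − y,
-- namely that W holds for every label of y taken from the set at the image of s.
-- It is enough that M(u) contains these labels, which is a condition on arcs.
-- Acyclicity of Q lets it be built up by adding leaves one at a time.
module Submission where

open import Defs
open import Data.Product using (Σ)
open import Data.Sum using (_⊎_)
open import Function.Bundles using (_⇔_)

open import Data.Empty using (⊥-elim)
open import Data.Fin.Base using (Fin; zero; suc; inject₁; fromℕ; opposite; finToFun; funToFin)
open import Data.Fin.Patterns using (0F; 1F)
open import Data.Fin.Properties as Fin using (finToFun-funToFin; *↔×; opposite-involutive; injective⇒≤; any?)
import Data.List.Base as List
open import Data.List.Membership.Propositional using (_∈_)
open import Data.List.Membership.Propositional.Properties using (∈-allFin; ∈-filter⁺; ∈-filter⁻; ∈-lookup)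
open import Data.List.Relation.Unary.Any as Any using ()
open import Data.List.Relation.Unary.Any.Properties using (lookup-index)
open import Data.Nat.Base using (ℕ; zero; suc; _+_; _*_; _^_; _<_; _≤_; s≤s)
open import Data.Nat.Properties using (<⇒≱; +-identityʳ; +-suc; ≤-reflexive)
open import Data.Product.Base using (∃-syntax; _×_; _,_; proj₁; proj₂; uncurry)
open import Data.Product.Function.NonDependent.Propositional using (_×-↔_)
open import Data.Sum.Base using (inj₁; inj₂)
open import Data.Unit.Base using (⊤; tt)
open import Data.Vec.Base as Vec using (Vec; []; _∷_; lookup; tabulate)
import Data.Vec.Functional as Vector
open import Data.Vec.Properties using (lookup-map; map-∘; lookup∘tabulate)
open import Function.Base using (id; _∘_)
open import Function.Bundles using (_↔_; mk⇔; module Inverse; module Injection; module Equivalence)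
open import Function.Definitions using (Injective)
open import Function.Properties.Equivalence using () renaming (trans to ⇔-trans)
open import Function.Properties.Inverse using (↔-refl; ↔-sym; ↔-trans; ↔⇒↣)
open import Relation.Binary.Construct.Closure.ReflexiveTransitive using (Star; _◅_)
open import Relation.Binary.PropositionalEquality
  using (_≡_; refl; sym; trans; cong; subst; subst₂)
open import Relation.Nullary using (¬_; Dec; yes; no; contradiction)
open import Relation.Nullary.Decidable using (map′; recompute; decidable-stable; ¬?; _×-dec_; _→-dec_)
open import Relation.Unary using (Decidable)

open Digraph using (finite)

⟶-id : ∀ G → G ⟶ G
⟶-id G = mkHom {G} {G} id λ _ _ a → a

∘ʰ-⟨⟩ : ∀ {G H K} (g : H ⟶ K) (f : G ⟶ H) u → (_∘ʰ_ {G} {H} {K} g f) ⟨ u ⟩ ≡ g ⟨ f ⟨ u ⟩ ⟩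
∘ʰ-⟨⟩ {G} {H} {K} g f = mkHom-⟨⟩ {G} {K} _
  λ u v a → preserves {H} {K} g _ _ (preserves {G} {H} f u v a)

-- Oriented trees grown leaf by leaf, and labellings of digraphs.

data Orientation : Set where
  out into : Orientation

orient : ∀ {a b} {A : Set a} {B : Set b} → Orientation → (A → A → B) → A → A → B
orient out  f x y = f x y
orient into f x y = f y x

-- graft o s t renumbers the vertices i of t as suc i and joins the new vertex zero
-- to suc s, by an arc leaving zero if o is out.
data OrientedTree : ℕ → Set where
  point : OrientedTree 0
  graft : ∀ {n} → Orientation → Fin (suc n) → OrientedTree n → OrientedTree (suc n)

source target : ∀ {n} → OrientedTree n → Fin n → Fin (suc n)
source (graft o s t) zero    = orient o (λ x _ → x) zero (suc s)
source (graft o s t) (suc i) = suc (source t i)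
target (graft o s t) zero    = orient o (λ _ y → y) zero (suc s)
target (graft o s t) (suc i) = suc (target t i)

-- Vertex and arc labels are kept side by side so that one elimination serves both shapes of `P`:
-- even if only arcs are labelled at first, the sets added by elimination sit on vertices.
record LabelledDigraph : Set₁ where
  field
    {L T}   : Set
    {#L #T} : ℕ
    L-finite : L ↔ Fin #L
    T-finite : T ↔ Fin #T
    R  : L → T → L → Set
    R? : ∀ x t y → Dec (R x t y)

open LabelledDigraph using (L; T)

record Labelling (D : LabelledDigraph) (G : Digraph) : Set where
  open LabelledDigraph D using (R)
  field
    vertexLabel : V G → L D
    -- Irrelevance makes the label independent of the proof that (u , v) is an arc.
    arcLabel    : ∀ u v → .(Arc G u v) → T D
    consistent  : ∀ u v .(a : Arc G u v) → R (vertexLabel u) (arcLabel u v a) (vertexLabel v)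

open Labelling

IsTreeHom : ∀ {n} → OrientedTree n → (G : Digraph) → Vec (V G) (suc n) → Set
IsTreeHom t G w = ∀ i → Arc G (lookup w (source t i)) (lookup w (target t i))

Constraint : ℕ → LabelledDigraph → Set₁
Constraint n D = Vec (L D) (suc n) → Vec (T D) n → Set

Satisfies : ∀ {n D G} → OrientedTree n → Constraint n D → Labelling D G → Set
Satisfies {G = G} t W x = ∀ w (h : IsTreeHom t G w) →
  W (Vec.map (vertexLabel x) w) (tabulate λ i → arcLabel x _ _ (h i))

ConstrainedLabelling : ∀ {n D} → OrientedTree n → Constraint n D → Digraph → Set
ConstrainedLabelling {D = D} t W G = Σ (Labelling D G) (Satisfies t W)

module _ (G : Digraph) where

  ArcAlong : Orientation → V G → V G → Set
  ArcAlong o = orient o (Arc G)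

  arcAlong? : ∀ o u v → Dec (ArcAlong o u v)
  arcAlong? out  u v = arc? G u v
  arcAlong? into u v = arc? G v u

module _ {n} {G : Digraph} (s : Fin (suc n)) (v : V G) (w : Vec (V G) (suc n)) where

  -- What the arc `zero` of `graft o s t` becomes under `v ∷ w`. It is stuck on a variable `o`,
  -- hence the conversions to and from `ArcAlong`.
  GraftedArc : Orientation → Set
  GraftedArc o = Arc G (lookup (v ∷ w) (orient o (λ x _ → x) zero (suc s)))
                       (lookup (v ∷ w) (orient o (λ _ y → y) zero (suc s)))

  graftArc⁺ : ∀ o → ArcAlong G o v (lookup w s) → GraftedArc o
  graftArc⁺ out  a = a
  graftArc⁺ into a = a

  graftArc⁻ : ∀ o → GraftedArc o → ArcAlong G o v (lookup w s)
  graftArc⁻ out  a = a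
  graftArc⁻ into a = a

module _ {D G} (x : Labelling D G) where

  labelAlong : ∀ o v u → .(ArcAlong G o v u) → T D
  labelAlong out  v u a = arcLabel x v u a
  labelAlong into v u a = arcLabel x u v a

  labelAlong-graft : ∀ {n} (s : Fin (suc n)) v w o .(a : ArcAlong G o v (lookup w s))
                     .(b : GraftedArc {G = G} s v w o) →
                     labelAlong o v (lookup w s) a ≡ arcLabel x _ _ b
  labelAlong-graft s v w out  a b = refl
  labelAlong-graft s v w into a b = refl

-- Elimination of a leaf.

bit : ∀ {A : Set} → Dec A → Fin 2
bit (yes _) = 1F
bit (no _)  = 0F

bit⁻ : ∀ {A : Set} (A? : Dec A) → bit A? ≡ 1F → A
bit⁻ (yes a) _ = a

bit⁺ : ∀ {A : Set} (A? : Dec A) → A → bit A? ≡ 1F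
bit⁺ (yes _) _ = refl
bit⁺ (no ¬a) a = contradiction a ¬a

module Elimination (D : LabelledDigraph) where
  open LabelledDigraph D hiding (L; T)

  pairs : (L D × T D) ↔ Fin (#L * #T)
  pairs = ↔-trans (L-finite ×-↔ T-finite) (↔-sym *↔×)

  Subsets : Set
  Subsets = Fin (2 ^ (#L * #T))

  infix 4 _∋_
  _∋_ : Subsets → L D × T D → Set
  M ∋ p = finToFun {2} M (Inverse.to pairs p) ≡ 1F

  _∋?_ : ∀ M p → Dec (M ∋ p)
  M ∋? p = _ Fin.≟ _

  module _ {P : L D × T D → Set} (P? : Decidable P) where

    bits : Fin (#L * #T) → Fin 2
    bits i = bit (P? (Inverse.from pairs i))

    comprehension : Subsets
    comprehension = funToFin bits

    bits-to : ∀ p → finToFun {2} comprehension (Inverse.to pairs p) ≡ bit (P? p)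
    bits-to p = trans (finToFun-funToFin bits (Inverse.to pairs p))
      (cong (λ q → bit (P? q)) (Inverse.strictlyInverseʳ pairs p))

    ∋-comprehension⁻ : ∀ p → comprehension ∋ p → P p
    ∋-comprehension⁻ p m = bit⁻ (P? p) (trans (sym (bits-to p)) m)

    ∋-comprehension⁺ : ∀ p → P p → comprehension ∋ p
    ∋-comprehension⁺ p q = trans (bits-to p) (bit⁺ (P? p) q)

  -- The set is stored at the end where the leaf is attached, and the recorded vertex label comes
  -- from the other end. The arc label is recorded too, since `W` may depend on the label of the
  -- removed arc.
  Recorded : L D × Subsets → T D → L D × Subsets → Set
  Recorded (x , _) t (_ , M) = M ∋ (x , t)

  RecordedAlong : Orientation → L D × Subsets → T D → L D × Subsets → Set
  RecordedAlong o x t = orient o (λ x y → Recorded x t y) x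

  recordedAlong? : ∀ o x t y → Dec (RecordedAlong o x t y)
  recordedAlong? out  x t y = proj₂ y ∋? _
  recordedAlong? into x t y = proj₂ x ∋? _

  -- The second component of the label of u is the set M(u) for a leaf attached in
  -- direction o.
  extended : Orientation → LabelledDigraph
  extended o = record
    { L        = L D × Subsets
    ; L-finite = ↔-trans (L-finite ×-↔ ↔-refl) (↔-sym *↔×)
    ; T-finite = T-finite
    ; R        = λ x t y → R (proj₁ x) t (proj₁ y) × RecordedAlong o x t y
    ; R?       = λ x t y → R? _ t _ ×-dec recordedAlong? o x t y
    }

  module _ {G : Digraph} (x : Labelling D G) (M : V G → Subsets) where

    private
      ℓ : V G → L D × Subsets
      ℓ u = vertexLabel x u , M u

    recorded⁺ : ∀ o → (∀ v u (a : ArcAlong G o v u) → M u ∋ (vertexLabel x v , labelAlong x o v u a)) →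
                ∀ u v (a : Arc G u v) → RecordedAlong o (ℓ u) (arcLabel x u v a) (ℓ v)
    recorded⁺ out  r u v a = r u v a
    recorded⁺ into r u v a = r v u a

    recorded⁻ : ∀ o → (∀ u v .(a : Arc G u v) → RecordedAlong o (ℓ u) (arcLabel x u v a) (ℓ v)) →
                ∀ v u .(a : ArcAlong G o v u) → M u ∋ (vertexLabel x v , labelAlong x o v u a)
    recorded⁻ out  r v u a = r v u a
    recorded⁻ into r v u a = r u v a

  module _ {n} (o : Orientation) (s : Fin (suc n)) (W : Constraint (suc n) D) where

    -- Quantifying over the stored set rather than over neighbours makes this a condition on labels
    -- alone. A larger set only strengthens it, so containing the labels actually seen is enough.
    eliminated : Constraint n (extended o)
    eliminated xs ts = ∀ x t → proj₂ (lookup xs s) ∋ (x , t) → W (x ∷ Vec.map proj₁ xs) (t ∷ ts)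

    eliminated? : (∀ xs ts → Dec (W xs ts)) → ∀ xs ts → Dec (eliminated xs ts)
    eliminated? W? xs ts = allFinite? L-finite λ x → allFinite? T-finite λ t →
      (_ ∋? _) →-dec W? _ _

    module _ {G : Digraph} (t : OrientedTree n) where

      module _ (x : Labelling D G) where

        Neighbour : V G → L D × T D → Set
        Neighbour u (y , t) = ∃[ v ] Σ (ArcAlong G o v u) λ a →
                              vertexLabel x v ≡ y × labelAlong x o v u a ≡ t

        neighbour? : ∀ u → Decidable (Neighbour u)
        neighbour? u (y , t) = anyFinite? (finite G) λ v → labelled? v (arcAlong? G o v u)
          where
          labelled? : ∀ v → Dec (ArcAlong G o v u) →
                      Dec (Σ (ArcAlong G o v u) λ a → vertexLabel x v ≡ y × labelAlong x o v u a ≡ t)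
          labelled? v (no ¬a) = no λ (a , _) → ¬a a
          -- `labelAlong` ignores its arc proof, so equations stated for any other proof are already
          -- equations for `a`.
          labelled? v (yes a) = map′ (a ,_) proj₂
            (finite-≟ L-finite _ _ ×-dec finite-≟ T-finite _ _)

        neighbourhood : V G → Subsets
        neighbourhood u = comprehension (neighbour? u)

        extend : Labelling (extended o) G
        extend = record
          { vertexLabel = λ u → vertexLabel x u , neighbourhood u
          ; arcLabel    = arcLabel x
          ; consistent  = λ u v a → consistent x u v a ,
              recorded⁺ x neighbourhood o
                (λ v u b → ∋-comprehension⁺ (neighbour? u) _ (v , b , refl , refl))
                -- Membership in the neighbourhood needs a relevant arc as witness; decidability
                -- recovers one.
                u v (recompute (arc? G u v) a)
          }

        -- Each member of the computed set comes from an actual neighbour `v` of the image of `s`,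
        -- so `v ∷ w` is a homomorphism of the larger tree and `W` applies to it.
        extend-satisfies : Satisfies (graft o s t) W x → Satisfies t eliminated extend
        extend-satisfies sat w h y τ m
          with v , a , refl , refl ← ∋-comprehension⁻ (neighbour? (lookup w s)) (y , τ)
                 (subst (λ l → proj₂ l ∋ (y , τ)) (lookup-map s (vertexLabel extend) w) m)
          = subst₂ (λ xs τ → W (vertexLabel x v ∷ xs) (τ ∷ _))
              (map-∘ proj₁ (vertexLabel extend) w)
              (sym (labelAlong-graft x s v w o a (graftArc⁺ {G = G} s v w o a)))
              (sat (v ∷ w) λ { zero    → graftArc⁺ {G = G} s v w o a
                             ; (suc i) → h i })

      module _ (x : Labelling (extended o) G) where

        restrict : Labelling D G
        restrict = record
          { vertexLabel = λ u → proj₁ (vertexLabel x u)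
          ; arcLabel    = arcLabel x
          ; consistent  = λ u v a → proj₁ (consistent x u v a)
          }

        -- By consistency, the arc between `v` and the image of `s` is recorded there, so the
        -- eliminated constraint can be instantiated at its labels.
        restrict-satisfies : Satisfies t eliminated x → Satisfies (graft o s t) W restrict
        restrict-satisfies sat (v ∷ w) h =
          subst₂ (λ xs τ → W (vertexLabel restrict v ∷ xs) (τ ∷ τs))
            (sym (map-∘ proj₁ (vertexLabel x) w))
            (labelAlong-graft restrict s v w o a (h zero))
            (sat w (λ i → h (suc i)) _ _
              (subst (λ l → proj₂ l ∋ (vertexLabel restrict v , labelAlong restrict o v (lookup w s) a))
                (sym (lookup-map s (vertexLabel x) w))
                (recorded⁻ restrict (λ u → proj₂ (vertexLabel x u)) o
                  (λ u v b → proj₂ (consistent x u v b)) v (lookup w s) a)))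
          where
          a : ArcAlong G o v (lookup w s)
          a = graftArc⁻ {G = G} s v w o (h zero)
          τs : Vec (T D) n
          τs = tabulate λ i → arcLabel x _ _ (h (suc i))

      -- The two maps need not be inverse: extending after restricting may shrink the stored sets.
      eliminate : ConstrainedLabelling {D = D} (graft o s t) W G ⇔
                  ConstrainedLabelling {D = extended o} t eliminated G
      eliminate = mk⇔ (λ (x , sat) → extend x , extend-satisfies x sat)
                      (λ (x , sat) → restrict x , restrict-satisfies x sat)

-- Constraints on a single vertex, and representability.

module _ (D : LabelledDigraph) (W : Constraint 0 D) (W? : ∀ xs ts → Dec (W xs ts)) where
  open LabelledDigraph D hiding (L; T)
  open Inverse L-finite using (to; from; strictlyInverseʳ)

  private
    admissible? : Decidable (λ i → W (from i ∷ []) [])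
    admissible? i = W? _ _

    admissibles : List.List (Fin #L)
    admissibles = List.filter admissible? (List.allFin #L)

    label : Fin (List.length admissibles) → L D
    label i = from (List.lookup admissibles i)

    admissible : ∀ i → W (label i ∷ []) []
    admissible i = proj₂ (∈-filter⁻ admissible? {xs = List.allFin #L} (∈-lookup i))

    module _ (x : L D) (p : W (x ∷ []) []) where

      member : to x ∈ admissibles
      member = ∈-filter⁺ admissible? (∈-allFin (to x))
        (subst (λ y → W (y ∷ []) []) (sym (strictlyInverseʳ x)) p)

      unlabel : Fin (List.length admissibles)
      unlabel = Any.index member

      label-unlabel : label unlabel ≡ x
      label-unlabel = trans (cong from (sym (lookup-index member))) (strictlyInverseʳ x)

  admissibleSubgraph : Digraph
  admissibleSubgraph = record
    { V = Fin (List.length admissibles) ; size = _ ; finite = ↔-refl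
    ; Arc  = λ i j → ∃[ t ] R (label i) t (label j)
    ; arc? = λ i j → anyFinite? T-finite λ t → R? _ t _
    }

  -- Every vertex of `G` is by itself an image of `point`, so `W` just selects the labels allowed at
  -- a vertex. Labels of distinct arcs can then be chosen independently, so an arc of the target
  -- need only assert that some label fits.
  pointConstraint⇔hom : ∀ G → ConstrainedLabelling {D = D} point W G ⇔ (G ⟶ admissibleSubgraph)
  pointConstraint⇔hom G = mk⇔
    (λ (x , sat) → let p = λ u → sat (u ∷ []) λ () in
      mkHom {G} {admissibleSubgraph} (λ u → unlabel (vertexLabel x u) (p u))
        λ u v a → arcLabel x u v a ,
          subst₂ (λ y z → R y _ z) (sym (label-unlabel _ (p u))) (sym (label-unlabel _ (p v)))
            (consistent x u v a))
    (λ g →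
      -- An arc label must be chosen from an irrelevant arc; `recompute` supplies the one that
      -- `preserves` expects.
      let arc : ∀ u v → .(Arc G u v) → Arc admissibleSubgraph (g ⟨ u ⟩) (g ⟨ v ⟩)
          arc = λ u v a → preserves {G} {admissibleSubgraph} g u v (recompute (arc? G u v) a)
      in record
        { vertexLabel = λ u → label (g ⟨ u ⟩)
        ; arcLabel    = λ u v a → proj₁ (arc u v a)
        ; consistent  = λ u v a → proj₂ (arc u v a)
        } , λ { (u ∷ []) _ → admissible (g ⟨ u ⟩) })

-- Induction on the tree, with `D` and `W` arbitrary because each elimination changes both.
-- Decidability of `W` is carried along for the filtering in the base case.
representable : ∀ {n} (t : OrientedTree n) (D : LabelledDigraph) (W : Constraint n D) →
                (∀ xs ts → Dec (W xs ts)) →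
                Σ Digraph λ K → ∀ G → ConstrainedLabelling {D = D} t W G ⇔ (G ⟶ K)
representable point D W W? = admissibleSubgraph D W W? , pointConstraint⇔hom D W W?
representable (graft o s t) D W W? =
  let K , iff = representable t (extended o) (eliminated o s W) (eliminated? o s W W?)
  in  K , λ G → ⇔-trans (eliminate o s W t) (iff G)
  where open Elimination D

-- Simple paths in undirected trees.

opposite-inject₁ : ∀ {n} (i : Fin n) → opposite (inject₁ i) ≡ suc (opposite i)
opposite-inject₁ zero    = refl
opposite-inject₁ (suc i) = cong inject₁ (opposite-inject₁ i)

opposite-fromℕ : ∀ n → opposite (fromℕ n) ≡ zero
opposite-fromℕ zero    = refl
opposite-fromℕ (suc n) = cong inject₁ (opposite-fromℕ n)

module _ {A : Set} (tree : UndirectedTree A) where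
  open UndirectedTree tree

  Image : ∀ {n} → (Fin n → A) → A → Set
  Image φ x = ∃[ i ] φ i ≡ x

  -- Injective sequences match the form of `acyclic`. Confinement to the image of `φ` lets a vertex
  -- outside the image be put in front without losing injectivity.
  record SimplePath {n} (φ : Fin n → A) (x y : A) : Set where
    field
      len       : ℕ
      vertices  : Fin (suc len) → A
      injective : Injective _≡_ _≡_ vertices
      steps     : ∀ i → vertices (inject₁ i) — vertices (suc i)
      start     : vertices zero ≡ x
      end       : vertices (fromℕ len) ≡ y
      inside    : ∀ i → Image φ (vertices i)

  trivialPath : ∀ {n} {φ : Fin n → A} {x} → Image φ x → SimplePath φ x x
  trivialPath {x = x} x∈φ = record
    { len       = 0
    ; vertices  = λ _ → x
    ; injective = λ { {zero} {zero} _ → refl }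
    ; steps     = λ ()
    ; start     = refl
    ; end       = refl
    ; inside    = λ _ → x∈φ
    }

  weakenPath : ∀ {n} {φ : Fin n → A} {x y} z → SimplePath φ x y → SimplePath (z Vector.∷ φ) x y
  weakenPath z p = record
    { SimplePath p
    ; inside = λ i → let j , eq = SimplePath.inside p i in suc j , eq
    }

  ∷-injective : ∀ {n} {φ : Fin n → A} {y} → ¬ Image φ y →
                Injective _≡_ _≡_ φ → Injective _≡_ _≡_ (y Vector.∷ φ)
  ∷-injective y∉φ inj {zero}  {zero}  eq = refl
  ∷-injective y∉φ inj {zero}  {suc j} eq = contradiction (j , sym eq) y∉φ
  ∷-injective y∉φ inj {suc i} {zero}  eq = contradiction (i , eq) y∉φ
  ∷-injective y∉φ inj {suc i} {suc j} eq = cong suc (inj eq)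

  module _ {n} {φ : Fin n → A} {x y z} (z∉φ : ¬ Image φ z) (z—x : z — x) (p : SimplePath φ x y) where
    open SimplePath p

    z∉path : ¬ Image vertices z
    z∉path (i , eq) = z∉φ (let j , eq′ = inside i in j , trans eq′ eq)

    steps-∷ : ∀ i → (z Vector.∷ vertices) (inject₁ i) — (z Vector.∷ vertices) (suc i)
    steps-∷ zero    = subst (z —_) (sym start) z—x
    steps-∷ (suc i) = steps i

    consPath : SimplePath (z Vector.∷ φ) z y
    consPath = record
      { len       = suc len
      ; vertices  = z Vector.∷ vertices
      ; injective = ∷-injective z∉path injective
      ; steps     = steps-∷
      ; start     = refl
      ; end       = end
      ; inside    = λ { zero → zero , refl ; (suc i) → let j , eq = inside i in suc j , eq }
      }

  -- A second neighbour y ≠ x of z would close the simple path z — x ⋯ y to a cycle.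
  unique-neighbour : ∀ {n} {φ : Fin n → A} {x y z} → ¬ Image φ z → SimplePath φ x y →
                     z — x → z — y → x ≡ y
  unique-neighbour z∉φ (record { len = zero ; start = s ; end = e }) z—x z—y = trans (sym s) e
  unique-neighbour {z = z} z∉φ p@(record { len = suc l ; end = e }) z—x z—y = ⊥-elim
    (acyclic l _ (∷-injective (z∉path z∉φ z—x p) (SimplePath.injective p)) (steps-∷ z∉φ z—x p)
       (subst (_— z) (sym e) (symmetric z—y)))

  reversePath : ∀ {n} {φ : Fin n → A} {x y} → SimplePath φ x y → SimplePath φ y x
  reversePath p = record
    { len       = len
    ; vertices  = vertices ∘ opposite
    ; injective = λ {i} {j} eq → trans (sym (opposite-involutive i))
                    (trans (cong opposite (injective eq)) (opposite-involutive j))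
    ; steps     = λ i → subst (λ j → vertices j — vertices (inject₁ (opposite i)))
                    (sym (opposite-inject₁ i)) (symmetric (steps (opposite i)))
    ; start     = end
    ; end       = trans (cong vertices (opposite-fromℕ len)) start
    ; inside    = inside ∘ opposite
    }
    where open SimplePath p

  -- Follow the walk until it first leaves `P`. With `P` the image of a partial presentation, this
  -- finds the next leaf.
  crossing : ∀ {P : A → Set} → Decidable P → ∀ {x y} → Star _—_ x y → P x → ¬ P y →
             ∃[ u ] ∃[ v ] P u × ¬ P v × u — v
  crossing P? Star.ε px ¬py = contradiction px ¬py
  crossing P? {x} (_◅_ {j = z} x—z z⋯y) px ¬py with P? z
  ... | yes pz = crossing P? z⋯y pz ¬py
  ... | no ¬pz = x , z , px , ¬pz , x—z

-- Presenting `Q` by successive leaves.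

module _ {Q : Digraph} (isTree : IsTree Q) where
  open IsTree isTree
  open UndirectedTree underlying

  -- A subtree of `Q` on `n + 1` vertices: `arcIndex` makes it an induced subgraph, and `path` joins
  -- its vertices inside it, so that an outside vertex with two neighbours in it would close a
  -- cycle.
  record PartialPresentation (n : ℕ) : Set where
    field
      tree       : OrientedTree n
      φ          : Fin (suc n) → V Q
      injective  : Injective _≡_ _≡_ φ
      treeArc    : ∀ i → Arc Q (φ (source tree i)) (φ (target tree i))
      arcIndex   : ∀ j k → Arc Q (φ j) (φ k) → ∃[ i ] source tree i ≡ j × target tree i ≡ k
      path       : ∀ j k → SimplePath underlying φ (φ j) (φ k)

    InImage : V Q → Set
    InImage = Image underlying φ

    inImage? : Decidable InImage
    inImage? u = any? λ i → finite-≟ (finite Q) (φ i) u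

  loop-free : ∀ u → ¬ Arc Q u u
  loop-free u a = loopless refl (arc⇒edge a)

  single : PartialPresentation 0
  single = record
    { tree      = point
    ; φ         = λ _ → nonempty
    ; injective = λ { {zero} {zero} _ → refl }
    ; treeArc   = λ ()
    ; arcIndex  = λ _ _ a → contradiction a (loop-free nonempty)
    ; path      = λ _ _ → trivialPath underlying (zero , refl)
    }

  orientation : ∀ {u v} → u — v → ∃[ o ] ArcAlong Q o u v
  orientation e with edge⇒arc e
  ... | inj₁ a = out , a
  ... | inj₂ a = into , a

  module _ {n} (p : PartialPresentation n) {y} (s : Fin (suc n))
           (y∉φ : ¬ PartialPresentation.InImage p y) (y—s : y — PartialPresentation.φ p s) where
    open PartialPresentation p

    -- By `unique-neighbour`, the only edge from `y` into the image goes to `φ s`, and `one-way`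
    -- leaves it one orientation; hence a single new arc keeps the image induced.
    attach : ∀ o → ArcAlong Q o y (φ s) → PartialPresentation (suc n)
    attach o b = record
      { tree      = graft o s tree
      ; φ         = φ′
      ; injective = ∷-injective underlying y∉φ injective
      ; treeArc   = λ { zero → newArc o b ; (suc i) → treeArc i }
      ; arcIndex  = arcIndex′ o b
      ; path      = path′
      }
      where
      φ′ : Fin (suc (suc n)) → V Q
      φ′ = y Vector.∷ φ

      newArc : ∀ o → ArcAlong Q o y (φ s) →
               Arc Q (φ′ (source (graft o s tree) zero)) (φ′ (target (graft o s tree) zero))
      newArc out  b = b
      newArc into b = b

      neighbour≡s : ∀ {j} → y — φ j → s ≡ j
      neighbour≡s {j} e = injective (unique-neighbour underlying y∉φ (path s j) y—s e)

      arcIndex′ : ∀ o → ArcAlong Q o y (φ s) → ∀ j k → Arc Q (φ′ j) (φ′ k) →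
                  ∃[ i ] source (graft o s tree) i ≡ j × target (graft o s tree) i ≡ k
      arcIndex′ o    b zero    zero    a = contradiction a (loop-free y)
      arcIndex′ o    b (suc j) (suc k) a =
        let i , eq₁ , eq₂ = arcIndex j k a in suc i , cong suc eq₁ , cong suc eq₂
      arcIndex′ o    b zero    (suc k) a with refl ← neighbour≡s (arc⇒edge a) with o
      ... | out  = zero , refl , refl
      ... | into = contradiction b (one-way a)
      arcIndex′ o    b (suc j) zero    a with refl ← neighbour≡s (symmetric (arc⇒edge a)) with o
      ... | out  = contradiction b (one-way a)
      ... | into = zero , refl , refl

      path′ : ∀ j k → SimplePath underlying φ′ (φ′ j) (φ′ k)
      path′ zero    zero    = trivialPath underlying (zero , refl)
      path′ zero    (suc k) = consPath underlying y∉φ y—s (path s k)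
      path′ (suc j) zero    = reversePath underlying (consPath underlying y∉φ y—s (path s j))
      path′ (suc j) (suc k) = weakenPath underlying y (path j k)

  record Presentation : Set where
    field
      {n}     : ℕ
      partial : PartialPresentation n
    open PartialPresentation partial public
    field
      surjective : ∀ u → InImage u

    position : V Q → Fin (suc n)
    position u = proj₁ (surjective u)

    φ-position : ∀ u → φ (position u) ≡ u
    φ-position u = proj₂ (surjective u)

  size-bound : ∀ {n} → PartialPresentation n → suc n ≤ size Q
  size-bound p = injective⇒≤ λ eq → injective (Injection.injective (↔⇒↣ (finite Q)) eq)
    where open PartialPresentation p

  -- `k` is fuel: each attached vertex moves one unit from `k` to `n`, preserving the bound. At
  -- `k = 0` the bound would place more than `size Q` distinct vertices in `Q`.
  complete : ∀ k {n} → PartialPresentation n → size Q < k + suc n → Presentation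
  complete zero    p bound = contradiction (size-bound p) (<⇒≱ bound)
  complete (suc k) {n} p bound = extend (anyFinite? (finite Q) (¬? ∘ inImage?))
    where
    open PartialPresentation p
    extend : Dec (∃[ u ] ¬ InImage u) → Presentation
    extend (no ¬missing) = record
      { partial    = p
      ; surjective = λ u → decidable-stable (inImage? u) λ u∉φ → ¬missing (u , u∉φ)
      }
    extend (yes (u , u∉φ))
      -- The missing vertex `u` may be far from the image; the vertex attached is the outer end `y`
      -- of an edge leaving the image on the way to `u`.
      with _ , y , (s , refl) , y∉φ , s—y ← crossing underlying inImage? (connected (φ zero) u) (zero , refl) u∉φ
      = complete k (uncurry (attach p s y∉φ (symmetric s—y)) (orientation (symmetric s—y)))
          (subst (size Q <_) (sym (+-suc k (suc n))) bound)

  presentation : Presentation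
  presentation = complete (size Q) single
    (subst (size Q <_) (sym (+-suc (size Q) 0)) (s≤s (≤-reflexive (sym (+-identityʳ _)))))

  -- Homomorphisms from `Q` and from its presentation.

  module _ (pres : Presentation) (G : Digraph) where
    open Presentation pres

    module _ (w : Vec (V G) (suc n)) (f : IsTreeHom tree G w) where

      treeHom⇒isHom : IsHom Q G (λ u → lookup w (position u))
      treeHom⇒isHom u v a
        with i , eq₁ , eq₂ ← arcIndex (position u) (position v)
               (subst₂ (Arc Q) (sym (φ-position u)) (sym (φ-position v)) a)
        = subst₂ (λ j k → Arc G (lookup w j) (lookup w k)) eq₁ eq₂ (f i)

      treeHom⇒hom : Q ⟶ G
      treeHom⇒hom = mkHom {Q} {G} _ treeHom⇒isHom

      treeHom⇒hom-⟨⟩ : ∀ u → treeHom⇒hom ⟨ u ⟩ ≡ lookup w (position u)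
      treeHom⇒hom-⟨⟩ = mkHom-⟨⟩ {Q} {G} _ treeHom⇒isHom

    module _ (h : Q ⟶ G) where

      valueAt : Fin (suc n) → V G
      valueAt i = h ⟨ φ i ⟩

      values : Vec (V G) (suc n)
      values = tabulate valueAt

      values-isTreeHom : IsTreeHom tree G values
      values-isTreeHom i = subst₂ (Arc G) (sym (lookup∘tabulate valueAt (source tree i)))
        (sym (lookup∘tabulate valueAt (target tree i))) (preserves {Q} {G} h _ _ (treeArc i))

      lookup-values : ∀ u → lookup values (position u) ≡ h ⟨ u ⟩
      lookup-values u = trans (lookup∘tabulate valueAt (position u)) (cong (h ⟨_⟩) (φ-position u))

-- The representing digraph for each shape of `P`.

RightAdjointAt : PultrTemplate → Digraph → Set₁
RightAdjointAt 𝒯 H = Σ Digraph λ K → ∀ G → (Γ 𝒯 G ⟶ H) ⇔ (G ⟶ K)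

module _ (𝒯 : PultrTemplate) (isTree : IsTree (Q 𝒯)) (pres : Presentation isTree) (H : Digraph) where
  open Presentation pres

  module PointCase (P≅P⃗₀ : P 𝒯 ≅ P⃗₀) where
    open Inverse (_≅_.bijection P≅P⃗₀) using (to; from; strictlyInverseʳ)

    pt : V (P 𝒯)
    pt = from 0F

    pt-unique : ∀ u → pt ≡ u
    pt-unique u with to u | strictlyInverseʳ u
    ... | 0F | eq = eq

    -- Vertices of `Γ 𝒯 G` correspond to those of `G`, so they are labelled by vertices of `H`. The
    -- arcs of `H` enter through `W`, at the two vertices of `Q` marked by `ε₁` and `ε₂`.
    labels : LabelledDigraph
    labels = record
      { L-finite = finite H ; T-finite = ↔-refl {A = Fin 1}
      ; R = λ _ _ _ → ⊤ ; R? = λ _ _ _ → yes tt }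

    i₁ i₂ : Fin (suc n)
    i₁ = position (ε₁ 𝒯 ⟨ pt ⟩)
    i₂ = position (ε₂ 𝒯 ⟨ pt ⟩)

    W : Constraint n labels
    W xs _ = Arc H (lookup xs i₁) (lookup xs i₂)

    module _ (G : Digraph) where

      const-isHom : ∀ v → IsHom (P 𝒯) G (λ _ → v)
      const-isHom v u u′ a = ⊥-elim (Equivalence.to (_≅_.arcs P≅P⃗₀ u u′) a)

      constHom : V G → P 𝒯 ⟶ G
      constHom v = mkHom {P 𝒯} {G} (λ _ → v) (const-isHom v)

      constHom-≡ : ∀ v (g : P 𝒯 ⟶ G) → g ⟨ pt ⟩ ≡ v → constHom v ≡ g
      constHom-≡ v g eq = Hom-ext {P 𝒯} {G} λ u →
        trans (mkHom-⟨⟩ {P 𝒯} {G} _ (const-isHom v) u) (trans (sym eq) (cong (g ⟨_⟩) (pt-unique u)))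

      fromHom : Γ 𝒯 G ⟶ H → ConstrainedLabelling {D = labels} tree W G
      fromHom F = x , sat
        where
        x : Labelling labels G
        x = record { vertexLabel = λ v → F ⟨ constHom v ⟩ ; arcLabel = λ _ _ _ → 0F ; consistent = _ }

        sat : Satisfies tree W x
        sat w f = subst₂ (Arc H) (value (ε₁ 𝒯)) (value (ε₂ 𝒯))
          (preserves {Γ 𝒯 G} {H} F _ _ (h , refl , refl))
          where
          h : Q 𝒯 ⟶ G
          h = treeHom⇒hom isTree pres G w f
          value : ∀ ε → F ⟨ _∘ʰ_ {P 𝒯} {Q 𝒯} {G} h ε ⟩ ≡
                        lookup (Vec.map (vertexLabel x) w) (position (ε ⟨ pt ⟩))
          value ε = sym (trans (lookup-map (position (ε ⟨ pt ⟩)) (vertexLabel x) w)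
            (cong (F ⟨_⟩) (constHom-≡ _ (_∘ʰ_ {P 𝒯} {Q 𝒯} {G} h ε) (trans (∘ʰ-⟨⟩ {P 𝒯} {Q 𝒯} {G} h ε pt)
              (treeHom⇒hom-⟨⟩ isTree pres G w f _)))))

      toHom : ConstrainedLabelling {D = labels} tree W G → Γ 𝒯 G ⟶ H
      toHom (x , sat) = mkHom {Γ 𝒯 G} {H} F isHom
        where
        F : P 𝒯 ⟶ G → V H
        F g = vertexLabel x (g ⟨ pt ⟩)

        isHom : IsHom (Γ 𝒯 G) H F
        isHom _ _ (h , refl , refl) = subst₂ (Arc H) (value (ε₁ 𝒯)) (value (ε₂ 𝒯))
          (sat (values isTree pres G h) (values-isTreeHom isTree pres G h))
          where
          value : ∀ ε → lookup (Vec.map (vertexLabel x) (values isTree pres G h)) (position (ε ⟨ pt ⟩)) ≡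
                        F (_∘ʰ_ {P 𝒯} {Q 𝒯} {G} h ε)
          value ε = trans (lookup-map (position (ε ⟨ pt ⟩)) (vertexLabel x) (values isTree pres G h))
            (cong (vertexLabel x) (trans (lookup-values isTree pres G h _)
              (sym (∘ʰ-⟨⟩ {P 𝒯} {Q 𝒯} {G} h ε pt))))

    rightAdjointAt : RightAdjointAt 𝒯 H
    rightAdjointAt =
      let K , iff = representable tree labels W (λ _ _ → arc? H _ _)
      in  K , λ G → ⇔-trans (mk⇔ (fromHom G) (toHom G)) (iff G)

  module ArcCase (P≅P⃗₁ : P 𝒯 ≅ P⃗₁) where
    open Inverse (_≅_.bijection P≅P⃗₁) using (to; from; strictlyInverseʳ; strictlyInverseˡ)

    p₀ p₁ : V (P 𝒯)
    p₀ = from 0F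
    p₁ = from 1F

    p₀p₁ : Arc (P 𝒯) p₀ p₁
    p₀p₁ = Equivalence.from (_≅_.arcs P≅P⃗₁ p₀ p₁) (strictlyInverseˡ 0F , strictlyInverseˡ 1F)

    -- Vertices of `Γ 𝒯 G` now correspond to arcs of `G`, so the vertices of `H` serve as arc
    -- labels.
    labels : LabelledDigraph
    labels = record
      { L-finite = ↔-refl {A = Fin 1} ; T-finite = finite H
      ; R = λ _ _ _ → ⊤ ; R? = λ _ _ _ → yes tt }

    -- `ε` sends the arc of `P` to an arc of `Q`; its index in the presentation tells `W` which
    -- label to read.
    imageArc : ∀ (ε : P 𝒯 ⟶ Q 𝒯) → ∃[ i ] source tree i ≡ position (ε ⟨ p₀ ⟩) ×
                                            target tree i ≡ position (ε ⟨ p₁ ⟩)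
    imageArc ε = arcIndex _ _ (subst₂ (Arc (Q 𝒯)) (sym (φ-position _)) (sym (φ-position _))
      (preserves {P 𝒯} {Q 𝒯} ε _ _ p₀p₁))

    index : (P 𝒯 ⟶ Q 𝒯) → Fin n
    index ε = proj₁ (imageArc ε)

    W : Constraint n labels
    W _ ts = Arc H (lookup ts (index (ε₁ 𝒯))) (lookup ts (index (ε₂ 𝒯)))

    module _ (G : Digraph) where

      endpoint : V G → V G → Fin 2 → V G
      endpoint u v 0F = u
      endpoint u v 1F = v

      endpoint-isHom : ∀ u v → Arc G u v → IsHom (P 𝒯) G (endpoint u v ∘ to)
      endpoint-isHom u v a x y b with to x | to y | Equivalence.to (_≅_.arcs P≅P⃗₁ x y) b
      ... | _ | _ | refl , refl = a

      arcHom : ∀ u v → Arc G u v → P 𝒯 ⟶ G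
      arcHom u v a = mkHom {P 𝒯} {G} (endpoint u v ∘ to) (endpoint-isHom u v a)

      arcHom-≡ : ∀ u v (a : Arc G u v) (g : P 𝒯 ⟶ G) → g ⟨ p₀ ⟩ ≡ u → g ⟨ p₁ ⟩ ≡ v → arcHom u v a ≡ g
      arcHom-≡ u v a g refl refl = Hom-ext {P 𝒯} {G} λ x →
        trans (mkHom-⟨⟩ {P 𝒯} {G} _ (endpoint-isHom _ _ a) x) (pointwise x)
        where
        pointwise : ∀ x → endpoint (g ⟨ p₀ ⟩) (g ⟨ p₁ ⟩) (to x) ≡ g ⟨ x ⟩
        pointwise x with to x | strictlyInverseʳ x
        ... | 0F | refl = refl
        ... | 1F | refl = refl

      fromHom : Γ 𝒯 G ⟶ H → ConstrainedLabelling {D = labels} tree W G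
      fromHom F = x , sat
        where
        x : Labelling labels G
        x = record
          { vertexLabel = λ _ → 0F
          ; arcLabel    = λ u v a → F ⟨ arcHom u v (recompute (arc? G u v) a) ⟩
          ; consistent  = _
          }

        sat : Satisfies tree W x
        sat w f = subst₂ (Arc H) (value (ε₁ 𝒯)) (value (ε₂ 𝒯))
          (preserves {Γ 𝒯 G} {H} F _ _ (h , refl , refl))
          where
          h : Q 𝒯 ⟶ G
          h = treeHom⇒hom isTree pres G w f
          at : ∀ ε p {i} → i ≡ position (ε ⟨ p ⟩) → (_∘ʰ_ {P 𝒯} {Q 𝒯} {G} h ε) ⟨ p ⟩ ≡ lookup w i
          at ε p refl = trans (∘ʰ-⟨⟩ {P 𝒯} {Q 𝒯} {G} h ε p) (treeHom⇒hom-⟨⟩ isTree pres G w f _)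
          value : ∀ ε → F ⟨ _∘ʰ_ {P 𝒯} {Q 𝒯} {G} h ε ⟩ ≡
                        lookup (tabulate λ i → arcLabel x _ _ (f i)) (index ε)
          value ε = let _ , eq₁ , eq₂ = imageArc ε in
            sym (trans (lookup∘tabulate (λ i → arcLabel x _ _ (f i)) (index ε))
              (cong (F ⟨_⟩) (arcHom-≡ _ _ (f (index ε)) (_∘ʰ_ {P 𝒯} {Q 𝒯} {G} h ε) (at ε p₀ eq₁) (at ε p₁ eq₂))))

      -- Irrelevance of the arc argument reduces the comparison to the endpoints.
      arcLabel-cong : ∀ (x : Labelling labels G) {u u′ v v′} → u ≡ u′ → v ≡ v′ →
                      .(a : Arc G u v) .(a′ : Arc G u′ v′) → arcLabel x u v a ≡ arcLabel x u′ v′ a′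
      arcLabel-cong x refl refl a a′ = refl

      toHom : ConstrainedLabelling {D = labels} tree W G → Γ 𝒯 G ⟶ H
      toHom (x , sat) = mkHom {Γ 𝒯 G} {H} F isHom
        where
        F : P 𝒯 ⟶ G → V H
        F g = arcLabel x (g ⟨ p₀ ⟩) (g ⟨ p₁ ⟩) (preserves {P 𝒯} {G} g _ _ p₀p₁)

        isHom : IsHom (Γ 𝒯 G) H F
        isHom _ _ (h , refl , refl) = subst₂ (Arc H) (value (ε₁ 𝒯)) (value (ε₂ 𝒯)) (sat w f)
          where
          w : Vec (V G) (suc n)
          w = values isTree pres G h
          f : IsTreeHom tree G w
          f = values-isTreeHom isTree pres G h
          at : ∀ ε p {i} → i ≡ position (ε ⟨ p ⟩) → lookup w i ≡ (_∘ʰ_ {P 𝒯} {Q 𝒯} {G} h ε) ⟨ p ⟩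
          at ε p refl = trans (lookup-values isTree pres G h _) (sym (∘ʰ-⟨⟩ {P 𝒯} {Q 𝒯} {G} h ε p))
          value : ∀ ε → lookup (tabulate λ i → arcLabel x _ _ (f i)) (index ε) ≡
                        F (_∘ʰ_ {P 𝒯} {Q 𝒯} {G} h ε)
          value ε = let _ , eq₁ , eq₂ = imageArc ε in
            trans (lookup∘tabulate (λ i → arcLabel x _ _ (f i)) (index ε))
              (arcLabel-cong x (at ε p₀ eq₁) (at ε p₁ eq₂) _ _)

    rightAdjointAt : RightAdjointAt 𝒯 H
    rightAdjointAt =
      let K , iff = representable tree labels W (λ _ _ → arc? H _ _)
      in  K , λ G → ⇔-trans (mk⇔ (fromHom G) (toHom G)) (iff G)

-- Monotonicity of H ↦ Ω H is formal: transpose Ω G ⟶ Ω G to Γ (Ω G) ⟶ G,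
-- compose with G ⟶ H and transpose back.
rightAdjoint : ∀ 𝒯 → (∀ H → RightAdjointAt 𝒯 H) →
               Σ DigraphFunctor λ Ω → ∀ (G H : Digraph) → (Γ 𝒯 G ⟶ H) ⇔ (G ⟶ obj Ω H)
rightAdjoint 𝒯 adj = Ω , λ G H → proj₂ (adj H) G
  where
  Ωobj : Digraph → Digraph
  Ωobj H = proj₁ (adj H)

  Ω : DigraphFunctor
  Ω = record
    { obj  = Ωobj
    ; mono = λ {G} {H} g → Equivalence.to (proj₂ (adj H) (Ωobj G))
        (_∘ʰ_ {Γ 𝒯 (Ωobj G)} {G} {H} g (Equivalence.from (proj₂ (adj G) (Ωobj G)) (⟶-id (Ωobj G))))
    }

theorem7p1 : (𝒯 : PultrTemplate) →
    (P 𝒯 ≅ P⃗₀) ⊎ (P 𝒯 ≅ P⃗₁) →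
    IsTree (Q 𝒯) →
    Σ DigraphFunctor λ Ω → ∀ (G H : Digraph) → (Γ 𝒯 G ⟶ H) ⇔ (G ⟶ obj Ω H)
theorem7p1 𝒯 (inj₁ P≅P⃗₀) isTree = rightAdjoint 𝒯 λ H → PointCase.rightAdjointAt 𝒯 isTree (presentation isTree) H P≅P⃗₀
theorem7p1 𝒯 (inj₂ P≅P⃗₁) isTree = rightAdjoint 𝒯 λ H → ArcCase.rightAdjointAt 𝒯 isTree (presentation isTree) H P≅P⃗₁
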